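{- (Epistemic loop-exit guarantee.) In the model of Peterson's two-thread algorithm described in the context, for each thread $i\in\{0,1\}$ and $j=1-i$, the formula $$\mathbf{Always}\Bigl(\mathsf{EnterCS}_i\rightarrow\mathbf{K}_i\,\mathsf{pre}_i\bigl(\neg(\mathtt{flag}[j]=1\wedge\mathtt{victim}=i)\bigr)\Bigr)$$ holds at every point.
   Context: **Program.** Threads are $0$ and $1$; for a thread $i$ write $j=1-i$. Shared variables: $\mathtt{flag}[0],\mathtt{flag}[1]\in\{0,1\}$ and $\mathtt{victim}\in\{0,1\}$. Thread $i$ executes, in program order: `flag[i]=1; victim=i; while (flag[j]==1 && victim==i) {spin}; critical section; flag[i]=0`. Its control locations are $\ell^{\mathsf{flag}}$ (about to execute `flag[i]=1`), $\ell^{\mathsf{victim}}$ (about to execute `victim=i`), $\ell^{\mathsf{waitF}},\ell^{\mathsf{waitV}}$ (spin loop), $\ell^{\mathsf{cs}}$ (critical section), $\ell^{\mathsf{exit}}$ (about to execute `flag[i]=0`); a terminated thread is accommodated by stuttering (a self-loop at a final location). The loop guard is split into read micro-steps with one shared access each: from $\ell^{\mathsf{waitF}}$ a step reads $\mathtt{flag}[j]$ and enters $\ell^{\mathsf{cs}}$ if it reads $0$, otherwise it moves to $\ell^{\mathsf{waitV}}$; from $\ell^{\mathsf{waitV}}$ a step reads $\mathtt{victim}$ and enters $\ell^{\mathsf{cs}}$ iff $\mathtt{victim}\neq i$, else it goes back to $\ell^{\mathsf{waitF}}$. **Runs.** A global state $s$ consists of the shared store and, for each thread $i$, a local component $s.\lambda_i$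 (control location and local variables, including, for each shared variable $x$ that $i$ reads, a last-read register that each $i$-step reading $x$ sets to the value of $x$ in the pre-state). A run is an infinite sequence $\pi=s_0s_1\cdots$ of global states in which each step $s_t\to s_{t+1}$ is a step of exactly one thread $\mathsf{act}(t)$; a step of one thread leaves the other thread's local component unchanged. Points are pairs $(\pi,t)$, $t\ge0$. **Temporal operators.** State predicates are evaluated in $s_t$; $\mathsf{at}(i,\ell)$ says that thread $i$ is at location $\ell$. $(\pi,t)\models i\ \mathsf{act}$ iff $\mathsf{act}(t)=i$. $(\pi,t)\models\mathbf{Prev}\,\phi$ iff $t>0$ and $(\pi,t-1)\models\phi$. $(\pi,t)\models\phi\,\mathbf{Since}\,\psi$ iff there is $0\le r\le t$ with $(\pi,r)\models\psi$ and $(\pi,k)\models\phi$ for all $r<k\le t$. $\mathbf{Always}\,\phi:=\neg(\top\,\mathbf{Since}\,\neg\phi)$. $\mathsf{after}_i:=\mathbf{Prev}(i\ \mathsf{act})$. $\mathbf{Prev}_i\,\phi:=\neg\mathsf{after}_i\ \mathbf{Since}\ (\mathsf{after}_i\wedge\phi)$. $\mathsf{pre}_i\,\phi:=\mathbf{Prev}_i(\mathbf{Prev}\,\phi)$ (truth of $\phi$ in the pre-state of $i$'s last step). $x=\mathbf{Prev}\,x$ holds at $(\pi,t)$ iff $t=0$ or $x$ has the same value in $s_{t-1}$ and $s_t$. **Events.** $\mathsf{SetFlag}_i:=\mathsf{after}_i\wedge\mathbf{Prev}\,\mathsf{at}(i,\ell^{\mathsf{flag}})$, $\mathsf{SetVictim}_i:=\mathsf{after}_i\wedge\mathbf{Prev}\,\mathsf{at}(i,\ell^{\mathsf{victim}})$,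 $\mathsf{ClearFlag}_i:=\mathsf{after}_i\wedge\mathbf{Prev}\,\mathsf{at}(i,\ell^{\mathsf{exit}})$, and $\mathsf{EnterCS}_i:=\mathsf{after}_i\wedge\mathsf{at}(i,\ell^{\mathsf{cs}})\wedge\mathbf{Prev}\bigl(\mathsf{at}(i,\ell^{\mathsf{waitF}})\vee\mathsf{at}(i,\ell^{\mathsf{waitV}})\bigr)$. **Model constraints.** The model consists of the runs at all points of which the following hold, for $i\in\{0,1\}$: $\mathbf{Always}(\neg\mathsf{after}_i\rightarrow \mathtt{flag}[i]=\mathbf{Prev}\,\mathtt{flag}[i])$; $\mathbf{Always}(\mathsf{SetFlag}_i\rightarrow\mathtt{flag}[i]=1)$; $\mathbf{Always}(\mathsf{ClearFlag}_i\rightarrow\mathtt{flag}[i]=0)$; $\mathbf{Always}(\mathsf{SetVictim}_i\rightarrow\mathtt{victim}=i)$; $\mathbf{Always}\bigl(\neg(\mathsf{SetVictim}_0\vee\mathsf{SetVictim}_1)\rightarrow\mathtt{victim}=\mathbf{Prev}\,\mathtt{victim}\bigr)$. **Knowledge.** $\mathsf{obs}_i(s)=s.\lambda_i$. If $k_1<\cdots<k_m$ are the indices $k<t$ with $\mathsf{act}(k)=i$, then $\mathsf{Hist}_i(\pi,t)=\langle\mathsf{obs}_i(s_0),\mathsf{obs}_i(s_{k_1+1}),\dots,\mathsf{obs}_i(s_{k_m+1}),\mathsf{obs}_i(s_t)\rangle$. $(\pi,t)\models\mathbf{K}_i\phi$ iff $(\pi',t')\models\phi$ for all points $(\pi',t')$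 of the model with $\mathsf{Hist}_i(\pi',t')=\mathsf{Hist}_i(\pi,t)$. -}

module Defs where

open import Data.Empty using (⊥)
open import Data.Fin using (Fin; opposite; _≟_)
open import Data.Fin.Patterns using (0F; 1F)
open import Data.List using (List; []; _∷_; _++_; map; filter; upTo)
open import Data.Nat using (ℕ; zero; suc; _≤_; _<_)
open import Data.Product using (_×_; _,_; ∃-syntax)
open import Data.Sum using (_⊎_)
open import Data.Unit using (⊤)
open import Data.Vec using (Vec; lookup; _[_]≔_)
open import Relation.Binary.PropositionalEquality using (_≡_; _≢_)
open import Relation.Nullary using (¬_)

Thread Bit : Set
Thread = Fin 2
Bit    = Fin 2

other : Thread → Thread
other = opposite

data Location : Set where
  ℓflag ℓvictim ℓwaitF ℓwaitV ℓcs ℓexit ℓfinal : Location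

record Store : Set where
  constructor store
  field
    flags  : Vec Bit 2
    victim : Thread

-- Thread i reads exactly two shared variables, flag[1-i] and victim, so its
-- local component carries one last-read register for each of them.
record Local : Set where
  constructor local
  field
    loc       : Location
    regFlag   : Bit
    regVictim : Thread

record State : Set where
  constructor state
  field
    shared : Store
    locals : Vec Local 2

open Store public
open Local public
open State public

flag : Thread → State → Bit
flag i s = lookup (flags (shared s)) i

victimOf : State → Thread
victimOf s = victim (shared s)

obs : Thread → State → Local
obs i s = lookup (locals s) i

infix 4 _⊢_⟶_

data _⊢_⟶_ (i : Thread) : Store × Local → Store × Local → Set where

  setFlag : ∀ {f v a b} →
    i ⊢ (store f v , local ℓflag a b) ⟶ (store (f [ i ]≔ 1F) v , local ℓvictim a b)

  setVictim : ∀ {f v a b} →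
    i ⊢ (store f v , local ℓvictim a b) ⟶ (store f i , local ℓwaitF a b)

  readFlag-enter : ∀ {f v a b} → lookup f (other i) ≡ 0F →
    i ⊢ (store f v , local ℓwaitF a b) ⟶ (store f v , local ℓcs (lookup f (other i)) b)

  readFlag-spin : ∀ {f v a b} → lookup f (other i) ≢ 0F →
    i ⊢ (store f v , local ℓwaitF a b) ⟶ (store f v , local ℓwaitV (lookup f (other i)) b)

  readVictim-enter : ∀ {f v a b} → v ≢ i →
    i ⊢ (store f v , local ℓwaitV a b) ⟶ (store f v , local ℓcs a v)

  readVictim-spin : ∀ {f v a b} → v ≡ i →
    i ⊢ (store f v , local ℓwaitV a b) ⟶ (store f v , local ℓwaitF a v)

  leaveCS : ∀ {f v a b} →
    i ⊢ (store f v , local ℓcs a b) ⟶ (store f v , local ℓexit a b)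

  clearFlag : ∀ {f v a b} →
    i ⊢ (store f v , local ℓexit a b) ⟶ (store (f [ i ]≔ 0F) v , local ℓfinal a b)

  stutter : ∀ {f v a b} →
    i ⊢ (store f v , local ℓfinal a b) ⟶ (store f v , local ℓfinal a b)

data Step (i : Thread) : State → State → Set where
  step : ∀ {σ σ′ ls l′} → i ⊢ (σ , lookup ls i) ⟶ (σ′ , l′) →
    Step i (state σ ls) (state σ′ (ls [ i ]≔ l′))

-- No condition is imposed on the initial state st 0.  The acting thread is part
-- of the run: when both threads are at ℓfinal the states do not determine it.
record Run : Set where
  field
    st    : ℕ → State
    act   : ℕ → Thread
    steps : ∀ t → Step (act t) (st t) (st (suc t))

open Run public

Point : Set
Point = Run × ℕ

-- Formulas are embedded shallowly, as predicates on points.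
Formula : Set₁
Formula = Point → Set

infix 2 _⊨_

_⊨_ : Point → Formula → Set
p ⊨ φ = φ p

infix  8 ~_
infixr 7 _∧_
infixr 6 _∨_
infixr 5 _⇒_
infix  4 _Since_

~_ : Formula → Formula
(~ φ) p = ¬ φ p

_∧_ _∨_ _⇒_ : Formula → Formula → Formula
(φ ∧ ψ) p = φ p × ψ p
(φ ∨ ψ) p = φ p ⊎ ψ p
(φ ⇒ ψ) p = φ p → ψ p

True : Formula
True _ = ⊤

now : (State → Set) → Formula
now P (π , t) = P (st π t)

at : Thread → Location → Formula
at i ℓ = now λ s → loc (obs i s) ≡ ℓ

flag[_]≐_ : Thread → Bit → Formula
flag[ i ]≐ b = now λ s → flag i s ≡ b

victim≐_ : Thread → Formula
victim≐ i = now λ s → victimOf s ≡ i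

acts : Thread → Formula
acts i (π , t) = act π t ≡ i

Prev : Formula → Formula
Prev φ (π , zero)  = ⊥
Prev φ (π , suc t) = φ (π , t)

_Since_ : Formula → Formula → Formula
(φ Since ψ) (π , t) =
  ∃[ r ] r ≤ t × ψ (π , r) × (∀ k → r < k → k ≤ t → φ (π , k))

Always : Formula → Formula
Always φ = ~ (True Since (~ φ))

after : Thread → Formula
after i = Prev (acts i)

Prev⟨_⟩ : Thread → Formula → Formula
Prev⟨ i ⟩ φ = (~ after i) Since (after i ∧ φ)

pre : Thread → Formula → Formula
pre i φ = Prev⟨ i ⟩ (Prev φ)

-- The formula x = Prev x, true by convention at time 0.
Unchanged : {A : Set} → (State → A) → Formula
Unchanged x (π , zero)  = ⊤
Unchanged x (π , suc t) = x (st π (suc t)) ≡ x (st π t)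

SetFlag SetVictim ClearFlag EnterCS : Thread → Formula
SetFlag   i = after i ∧ Prev (at i ℓflag)
SetVictim i = after i ∧ Prev (at i ℓvictim)
ClearFlag i = after i ∧ Prev (at i ℓexit)
EnterCS   i = after i ∧ at i ℓcs ∧ Prev (at i ℓwaitF ∨ at i ℓwaitV)

record Model (π : Run) : Set where
  field
    flag-frame   : ∀ i t → (π , t) ⊨ Always (~ after i ⇒ Unchanged (flag i))
    flag-set     : ∀ i t → (π , t) ⊨ Always (SetFlag i ⇒ flag[ i ]≐ 1F)
    flag-clear   : ∀ i t → (π , t) ⊨ Always (ClearFlag i ⇒ flag[ i ]≐ 0F)
    victim-set   : ∀ i t → (π , t) ⊨ Always (SetVictim i ⇒ victim≐ i)
    victim-frame : ∀ t → (π , t) ⊨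
      Always (~ (SetVictim 0F ∨ SetVictim 1F) ⇒ Unchanged victimOf)

Hist : Thread → Point → List Local
Hist i (π , t) =
  obs i (st π 0)
    ∷ map (λ k → obs i (st π (suc k))) (filter (λ k → act π k ≟ i) (upTo t))
    ++ obs i (st π t) ∷ []

K : Thread → Formula → Formula
K i φ p = ∀ π′ t′ → Model π′ → Hist i (π′ , t′) ≡ Hist i p → (π′ , t′) ⊨ φ

{-# OPTIONS --safe #-}

-- Only a read of flag[j] = 0 or of victim ≠ i takes thread i into ℓcs, and no
-- step of the other thread changes i's local component.  So at any point where
-- i is at ℓcs and has already acted, i's last step was such a read.  Both facts
-- about the point can be seen in i's history: its last entry is the current
-- local component, and it has an entry for each step of i.
module Submission where

open import Defs
open import Data.Fin using (_≟_)
open import Data.List using (upTo)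
open import Data.List.Membership.Propositional using (_∈_)
open import Data.List.Membership.Propositional.Properties
  using (∈-map⁺; ∈-map⁻; ∈-filter⁺; ∈-filter⁻; ∈-upTo⁺; ∈-upTo⁻)
open import Data.List.Properties using (∷-injectiveʳ; ∷ʳ-injective)
open import Data.Nat using (ℕ; suc; _≤_; _<_; s≤s⁻¹)
open import Data.Nat.Properties
  using (≤-refl; n<1+n; m≤n⇒m≤1+n; <⇒≱; m≤n⇒m<n∨m≡n)
open import Data.Product using (_×_; _,_; ∃-syntax; proj₂)
open import Data.Sum using (inj₁; inj₂)
open import Data.Vec using (lookup)
open import Data.Vec.Properties using (lookup∘update; lookup∘update′)
open import Data.Fin.Patterns using (0F; 1F)
open import Relation.Binary.PropositionalEquality
  using (_≡_; _≢_; refl; sym; trans; cong; subst; ≢-sym)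
open import Relation.Nullary using (¬_; yes; no; contradiction)

GuardTrue : Thread → Formula
GuardTrue i = flag[ other i ]≐ 1F ∧ victim≐ i

-- No step loops at `ℓcs`, so unification leaves only the two entering reads; each refutes one
-- conjunct of the guard.
⟶-cs⇒guard-false : ∀ {i σ l σ′ l′} → i ⊢ (σ , l) ⟶ (σ′ , l′) → loc l′ ≡ ℓcs →
  ¬ (lookup (flags σ) (other i) ≡ 1F × victim σ ≡ i)
⟶-cs⇒guard-false (readFlag-enter f≡0) _ (f≡1 , _) with () ← trans (sym f≡0) f≡1
⟶-cs⇒guard-false (readVictim-enter v≢i) _ (_ , v≡i) = v≢i v≡i

Step-cs⇒guard-false : ∀ {i s s′} → Step i s s′ → loc (obs i s′) ≡ ℓcs →
  ¬ (flag (other i) s ≡ 1F × victimOf s ≡ i)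
Step-cs⇒guard-false {i} (step {ls = ls} {l′ = l′} tr) at-cs =
  ⟶-cs⇒guard-false tr (trans (cong loc (sym (lookup∘update i ls l′))) at-cs)

Step-frame : ∀ {i j s s′} → j ≢ i → Step j s s′ → obs i s′ ≡ obs i s
Step-frame j≢i (step {ls = ls} {l′ = l′} _) = lookup∘update′ (≢-sym j≢i) ls l′

Acted : Thread → Point → Set
Acted i (π , t) = ∃[ k ] k < t × act π k ≡ i

-- Induction on time, back to the last step of `i`. `Acted` excludes a thread that has stood at
-- `ℓcs` since time 0, which an arbitrary initial state allows.
cs⇒pre-guard-false : ∀ i π t → Acted i (π , t) → (π , t) ⊨ at i ℓcs →
  (π , t) ⊨ pre i (~ GuardTrue i)
cs⇒pre-guard-false i π (suc t) (k , k<1+t , act-k) at-cs with act π t ≟ i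
... | yes act-t =
  -- `after i` at `suc t` refers to step `t`; no later point remains to be checked.
  suc t , ≤-refl
  , (act-t , Step-cs⇒guard-false (subst (λ j → Step j _ _) act-t (steps π t)) at-cs)
  , λ k t<k k≤t → contradiction k≤t (<⇒≱ t<k)
... | no ¬act-t with m≤n⇒m<n∨m≡n (s≤s⁻¹ k<1+t)
...   | inj₂ refl = contradiction act-k ¬act-t
...   | inj₁ k<t
  with r , r≤t , last , idle ← cs⇒pre-guard-false i π t (k , k<t , act-k)
         (trans (cong loc (sym (Step-frame ¬act-t (steps π t)))) at-cs)
  = r , m≤n⇒m≤1+n r≤t , last , idle′
  where
  idle′ : ∀ k → r < k → k ≤ suc t → (π , k) ⊨ ~ after i
  idle′ k r<k k≤1+t with m≤n⇒m<n∨m≡n k≤1+t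
  ... | inj₁ k<1+t = idle k r<k (s≤s⁻¹ k<1+t)
  ... | inj₂ refl  = ¬act-t

module _ {i π t π′ t′} (hist : Hist i (π′ , t′) ≡ Hist i (π , t)) where

  private
    unsnoc = ∷ʳ-injective _ _ (∷-injectiveʳ hist)

  Hist⇒obs : obs i (st π′ t′) ≡ obs i (st π t)
  Hist⇒obs = proj₂ unsnoc

  -- An entry in the middle part of one history must occur in that of the other, and so stems from a
  -- step of `i` there, perhaps at a different time `k′`.
  Hist⇒Acted : Acted i (π , t) → Acted i (π′ , t′)
  Hist⇒Acted (k , k<t , act-k)
    with k∈ ← ∈-map⁺ (λ k → obs i (st π (suc k)))
                (∈-filter⁺ (λ k → act π k ≟ i) (∈-upTo⁺ k<t) act-k)
    with steps≡ , _ ← unsnoc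
    with k′ , k′∈ , _ ← ∈-map⁻ _ (subst (_ ∈_) (sym steps≡) k∈)
    with k′∈upTo , act-k′ ← ∈-filter⁻ (λ k → act π′ k ≟ i) {xs = upTo t′} k′∈
    = k′ , ∈-upTo⁻ k′∈upTo , act-k′

-- `EnterCS i` may fail at `(π′ , t′)`, since the other thread may have moved after the entry; being
-- at `ℓcs` and having acted do transfer.
EnterCS⇒K : ∀ i π t → (π , t) ⊨ EnterCS i ⇒ K i (pre i (~ GuardTrue i))
EnterCS⇒K i π (suc t) (act-t , at-cs , _) π′ t′ _ hist =
  cs⇒pre-guard-false i π′ t′
    (Hist⇒Acted {π = π} {π′ = π′} hist (t , n<1+n t , act-t))
    (trans (cong loc (Hist⇒obs {π = π} {π′ = π′} hist)) at-cs)

mainTheorem5 : (i : Thread) (π : Run) → Model π → (t : ℕ) →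
    (π , t) ⊨ Always (EnterCS i ⇒ K i (pre i (~ (flag[ other i ]≐ 1F ∧ victim≐ i))))
mainTheorem5 i π _ t (r , _ , ¬enter⇒K , _) = ¬enter⇒K (EnterCS⇒K i π r)
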